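{- There is a polynomial $p$ such that for every instance $E=(U,C)$ of 3SAT, the temporal system $S'$ associated with $E$ attains a steady state in time at most $p(|U|)$.
   Context: An instance of 3SAT is $E=(U,C)$ with $U$ a finite set of variables taking values in $\{T,F\}$ and $C$ a finite set of disjunctive clauses $\omega_1\vee\omega_2\vee\omega_3$, each $\omega_i$ being $u$ or $\neg u$ for some $u\in U$ (variables may repeat within a clause). $\mathrm{varset}(c)$ is the set of variables occurring in the clause $c$. Clausal partition $D$ of $C$: the partition of $C$ in which two clauses lie in the same element iff they have the same set of variables (ignoring negation). For $d\in D$, $\mathrm{varset}(d)$ is this common set of variables (at most 3 variables). Instance graph $G=(V,\beta)$: $V$ is in bijection with $D$ (identify vertices with elements of $D$), and $\{d_i,d_j\}\in\beta$ iff $d_i\ne d_j$ and $0<|\mathrm{varset}(d_i)\cap\mathrm{varset}(d_j)|<3$. Each $d\in D$ carries a constraint set $R(d)\subseteq\{T,F\}^{\mathrm{varset}(d)}$ of excluded assignments; the assignments not in $R(d)$ are the admissible assignments of $d$. Implication operator $d_i\nabla d_j$ (defined when $W=\mathrm{varset}(d_i)\cap\mathrm{varset}(d_j)\neq\emptyset$): an assignment $w:W\to\{T,F\}$ is inadmissible in $d_i$ if every extension of $w$ to $\mathrm{varset}(d_i)$ belongs to $R(d_i)$; the operator adds to $R(d_j)$ every assignment to $\mathrm{varset}(d_j)$ whose restriction to $W$ is inadmissible in $d_i$, and changes nothing else. The temporal system $S'$ associated with $E$ models Part A of the algorithm: its state at time index $t=0,1,2,\dots$ is the tuple, indexed by $d\in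 D$, of the cardinalities (between $0$ and $8$) of the sets of admissible assignments of the elements $d$. At $t=0$, $R(d)$ is the set of assignments to $\mathrm{varset}(d)$ that fail at least one clause of $d$. Each time step performs one pass: for every $d_i\in D$ and every $d_j$ adjacent to $d_i$ in $G$, $d_i\nabla d_j$ is applied. A steady state is attained when a pass changes nothing. Time is measured by the total number of applications of $\nabla$ performed until the steady state is attained, each application of $\nabla$ taking constant time (independent of $|U|$). -}

module Defs where

open import Data.Bool.Base using (Bool; true; false; not; _∨_)
open import Data.Bool.ListAction using (all; any)
import Data.Bool.Properties as Bool
open import Data.Fin.Base using (Fin; zero; suc)
import Data.Fin.Properties as Fin
open import Data.Fin.Subset
  using (Subset; inside; outside; ⁅_⁆; _∪_; _∩_; _⊆_; ∣_∣)
open import Data.Fin.Subset.Properties using (drop-∷-⊆; p∩q⊆p; p∩q⊆q)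
open import Data.List.Base
  using (List; []; _∷_; [_]; _++_; map; foldr; length; lookup; filter; filterᵇ;
         allFin; cartesianProduct; deduplicate)
open import Data.Maybe.Base using (Maybe; just; nothing)
import Data.Maybe.Properties as Maybe
open import Data.Nat.Base using (ℕ; zero; suc; _+_; _*_; _<_)
open import Data.Nat.Properties using (_<?_)
open import Data.Product.Base using (_×_; _,_; uncurry)
open import Data.Vec.Base using ([]; _∷_; here)
import Data.Vec.Properties as Vec
open import Relation.Binary.Definitions using (DecidableEquality)
open import Relation.Binary.PropositionalEquality
  using (_≡_; _≢_; refl; cong)
open import Relation.Nullary
  using (¬_; Dec; yes; no; ¬?; _×-dec_; ⌊_⌋; map′)

-- Coefficients in order of increasing degree.

Polynomial : Set
Polynomial = List ℕ

eval : Polynomial → ℕ → ℕ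
eval p x = foldr (λ c r → c + x * r) 0 p

record Literal (n : ℕ) : Set where
  constructor literal
  field
    var  : Fin n
    sign : Bool   -- false for a negated variable

open Literal public

record Clause (n : ℕ) : Set where
  constructor clause
  field
    ω₁ ω₂ ω₃ : Literal n

open Clause public

varset : ∀ {n} → Clause n → Subset n
varset (clause ω₁ ω₂ ω₃) = ⁅ var ω₁ ⁆ ∪ (⁅ var ω₂ ⁆ ∪ ⁅ var ω₃ ⁆)

-- U is Fin n.  The finite set C is given by a list; repeated clauses have no
-- effect on anything below.

Instance : ℕ → Set
Instance n = List (Clause n)

-- Functions S → {T,F}, in a first-order form for which propositional equality
-- is extensional and decidable.

data Assignment : ∀ {n} → Subset n → Set where
  []   : Assignment []
  skip : ∀ {n} {S : Subset n} → Assignment S → Assignment (outside ∷ S)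
  _∷_  : ∀ {n} {S : Subset n} → Bool → Assignment S → Assignment (inside ∷ S)

infix 4 _≟ᴬ_

_≟ᴬ_ : ∀ {n} {S : Subset n} → DecidableEquality (Assignment S)
[]      ≟ᴬ []      = yes refl
skip a  ≟ᴬ skip b  = map′ (cong skip) (λ { refl → refl }) (a ≟ᴬ b)
(x ∷ a) ≟ᴬ (y ∷ b) = map′ (λ { (refl , refl) → refl }) (λ { refl → refl , refl })
                          (x Bool.≟ y ×-dec a ≟ᴬ b)

assignments : ∀ {n} (S : Subset n) → List (Assignment S)
assignments []            = [ [] ]
assignments (outside ∷ S) = map skip (assignments S)
assignments (inside ∷ S)  = map (true ∷_) (assignments S)
                         ++ map (false ∷_) (assignments S)

-- The result is nothing exactly for variables outside S.

value : ∀ {n} {S : Subset n} → Assignment S → Fin n → Maybe Bool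
value (skip a) zero    = nothing
value (skip a) (suc x) = value a x
value (b ∷ a)  zero    = just b
value (b ∷ a)  (suc x) = value a x

restrict : ∀ {n} {S W : Subset n} → W ⊆ S → Assignment S → Assignment W
restrict {W = []}          W⊆S []       = []
restrict {W = outside ∷ W} W⊆S (skip a) = skip (restrict (drop-∷-⊆ W⊆S) a)
restrict {W = outside ∷ W} W⊆S (b ∷ a)  = skip (restrict (drop-∷-⊆ W⊆S) a)
restrict {W = inside ∷ W}  W⊆S (b ∷ a)  = b ∷ restrict (drop-∷-⊆ W⊆S) a
restrict {W = inside ∷ W}  W⊆S (skip a) with () ← W⊆S here

extensions : ∀ {n} {S W : Subset n} → W ⊆ S → Assignment W → List (Assignment S)
extensions {S = S} W⊆S w = filter (λ a → restrict W⊆S a ≟ᴬ w) (assignments S)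

-- Literals with variables outside S count as false, but satisfies is only
-- applied to clauses all of whose variables lie in S.

satisfiesLiteral : ∀ {n} {S : Subset n} → Assignment S → Literal n → Bool
satisfiesLiteral a ω = ⌊ Maybe.≡-dec Bool._≟_ (value a (var ω)) (just (sign ω)) ⌋

satisfies : ∀ {n} {S : Subset n} → Assignment S → Clause n → Bool
satisfies a (clause ω₁ ω₂ ω₃) =
  satisfiesLiteral a ω₁ ∨ (satisfiesLiteral a ω₂ ∨ satisfiesLiteral a ω₃)

_≟ˢ_ : ∀ {n} → DecidableEquality (Subset n)
_≟ˢ_ = Vec.≡-dec Bool._≟_

module _ {n : ℕ} (E : Instance n) where

  -- An element of the clausal partition is indexed by the position of its
  -- common variable set among the distinct variable sets of clauses.

  varsets : List (Subset n)
  varsets = deduplicate _≟ˢ_ (map varset E)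

  D : Set
  D = Fin (length varsets)

  varsetᴰ : D → Subset n
  varsetᴰ = lookup varsets

  clausesᴰ : D → List (Clause n)
  clausesᴰ d = filter (λ c → varset c ≟ˢ varsetᴰ d) E

  Adjacent : D → D → Set
  Adjacent i j = i ≢ j × 0 < ∣ varsetᴰ i ∩ varsetᴰ j ∣ × ∣ varsetᴰ i ∩ varsetᴰ j ∣ < 3

  adjacent? : ∀ i j → Dec (Adjacent i j)
  adjacent? i j =
    ¬? (i Fin.≟ j) ×-dec
    0 <? ∣ varsetᴰ i ∩ varsetᴰ j ∣ ×-dec
    ∣ varsetᴰ i ∩ varsetᴰ j ∣ <? 3

  -- The family of constraint sets: R d a is true when a ∈ R(d).

  Constraints : Set
  Constraints = ∀ d → Assignment (varsetᴰ d) → Bool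

  initial : Constraints
  initial d a = any (λ c → not (satisfies a c)) (clausesᴰ d)

  inadmissible : Constraints → ∀ i {W} → W ⊆ varsetᴰ i → Assignment W → Bool
  inadmissible R i W⊆i w = all (R i) (extensions W⊆i w)

  -- ∇ i j is dᵢ ∇ dⱼ; it is only ever applied to adjacent i and j.

  ∇ : D → D → Constraints → Constraints
  ∇ i j R k a with k Fin.≟ j
  ... | no  _    = R k a
  ... | yes refl = R j a ∨ inadmissible R i
    (p∩q⊆p (varsetᴰ i) (varsetᴰ j))
    (restrict (p∩q⊆q (varsetᴰ i) (varsetᴰ j)) a)

  -- Ordered lexicographically: dᵢ in the outer loop, dⱼ in the inner one.

  schedule : List (D × D)
  schedule = filter (uncurry adjacent?)
                    (cartesianProduct (allFin (length varsets)) (allFin (length varsets)))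

  -- Each application acts on the result of the preceding ones.

  applyAll : List (D × D) → Constraints → Constraints
  applyAll []             R = R
  applyAll ((i , j) ∷ es) R = applyAll es (∇ i j R)

  pass : Constraints → Constraints
  pass = applyAll schedule

  constraints : ℕ → Constraints
  constraints zero    = initial
  constraints (suc t) = pass (constraints t)

  state : ℕ → D → ℕ
  state t d = length (filterᵇ (λ a → not (constraints t d a)) (assignments (varsetᴰ d)))

  -- The pass from time t to time suc t changes nothing: neither the state nor
  -- any of the constraint sets underlying it.

  Steady : ℕ → Set
  Steady t = (∀ d → state (suc t) d ≡ state t d)
           × (∀ d a → constraints (suc t) d a ≡ constraints t d a)

  AttainsSteadyStateAt : ℕ → Set
  AttainsSteadyStateAt t = Steady t × (∀ s → s < t → ¬ Steady s)

  -- Applications of ∇ up to and including the pass from t to suc t, which is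
  -- the one that shows the state at t to be steady.

  time : ℕ → ℕ
  time t = suc t * length schedule

-- Applying ∇ only ever enlarges constraint sets, and the pair (d , a) with
-- a ∈ R(d) ranges over at most 8 |D| possibilities, so at most 8 |D| passes can
-- change anything.  A clause determines its variable set through the triple of
-- its variables, whence |D| ≤ n³, and a pass makes at most |D|² applications.

module Submission where

open import Defs
open import Data.Bool.Base using (Bool; true; false; not; T)
open import Data.Bool.Properties using (T-∨; T?)
open import Data.Fin.Base using (Fin; zero; suc; combine)
open import Data.Fin.Properties as Fin using (combine-injective; injective⇒≤)
open import Data.Fin.Subset using (Subset; inside; outside; ⁅_⁆; _∪_; ∣_∣)
open import Data.Fin.Subset.Properties using (∣⁅x⁆∣≡1)
open import Data.List.Base
  using (List; []; _∷_; map; foldr; length; lookup; filterᵇ; allFin;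
         concatMap; cartesianProductWith; cartesianProduct)
open import Data.List.Membership.Propositional using (_∈_)
open import Data.List.Membership.Propositional.Properties
  using (∈-++⁺ˡ; ∈-++⁺ʳ; ∈-map⁺; ∈-map⁻; ∈-concatMap⁺; ∈-allFin; ∈-lookup;
         ∈-deduplicate⁻)
open import Data.List.Properties
  using (length-++; length-map; length-filter; length-tabulate; filter-≐)
open import Data.List.Relation.Unary.All using (_∷_) renaming (lookup to lookupᴬ)
open import Data.List.Relation.Unary.Any as Any using (here; there)
open import Data.List.Relation.Unary.Unique.DecPropositional.Properties
  using (deduplicate-!)
open import Data.List.Relation.Unary.Unique.Propositional using (Unique; _∷_)
open import Data.Nat.Base using (ℕ; zero; suc; _+_; _*_; _^_; _≤_; _<_; z≤n; s≤s)
open import Data.Nat.Properties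
open import Data.Nat.Solver using (module +-*-Solver)
open import Data.Product.Base using (∃-syntax; Σ-syntax; _×_; _,_; proj₁; uncurry)
open import Data.Sum.Base using (inj₁)
open import Data.Vec.Base using ([]; _∷_)
open import Function.Base using (_∘_; id)
open import Function.Bundles using (Equivalence)
open import Function.Definitions using (Injective)
open import Relation.Binary.PropositionalEquality
open import Relation.Nullary using (yes; no; contradiction)

-- By induction on `k`: if the first step is not a plateau, monotonicity makes `f 1` exceed `f 0`,
-- and the shifted sequence satisfies the bound with one unit of slack less. Measuring the bound
-- from `f 0` lets it survive the shift.
first-plateau : ∀ (f : ℕ → ℕ) → (∀ t → f t ≤ f (suc t)) →
                ∀ k → (∀ t → f t ≤ k + f 0) →
                ∃[ t ] (t ≤ k × f (suc t) ≡ f t × (∀ s → s < t → f (suc s) ≢ f s))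
first-plateau f mono k bound with f 1 ≟ f 0
... | yes f1≡f0 = 0 , z≤n , f1≡f0 , λ _ ()
first-plateau f mono zero    bound | no f1≢f0 =
  contradiction (≤-antisym (bound 1) (mono 0)) f1≢f0
first-plateau f mono (suc k) bound | no f1≢f0 =
  let t , t≤k , eq , least = first-plateau (f ∘ suc) (mono ∘ suc) k bound′
  in suc t , s≤s t≤k , eq , λ { zero _ → f1≢f0 ; (suc s) (s≤s s<t) → least s s<t }
  where
  bound′ : ∀ t → f (suc t) ≤ k + f 1
  bound′ t = ≤-trans (bound (suc t))
    (≤-trans (≤-reflexive (sym (+-suc k (f 0))))
             (+-monoʳ-≤ k (≤∧≢⇒< (mono 0) (f1≢f0 ∘ sym))))

-- Counting in lists

module _ {A : Set} where

  length-filterᵇ-mono : ∀ {p q : A → Bool} → (∀ x → T (p x) → T (q x)) →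
                        ∀ xs → length (filterᵇ p xs) ≤ length (filterᵇ q xs)
  length-filterᵇ-mono p⇒q [] = z≤n
  length-filterᵇ-mono {p} {q} p⇒q (x ∷ xs) with p x | q x | p⇒q x
  ... | false | false | _ = length-filterᵇ-mono p⇒q xs
  ... | false | true  | _ = m≤n⇒m≤1+n (length-filterᵇ-mono p⇒q xs)
  ... | true  | true  | _ = s≤s (length-filterᵇ-mono p⇒q xs)
  ... | true  | false | h = contradiction (h _) id

  -- As `p` implies `q`, a single listed element satisfying `q` but not `p` would already make the
  -- count for `q` strictly larger.
  length-filterᵇ-≡⇒≡ : ∀ {p q : A → Bool} → (∀ x → T (p x) → T (q x)) →
                       ∀ xs → length (filterᵇ q xs) ≡ length (filterᵇ p xs) →
                       ∀ {x} → x ∈ xs → q x ≡ p x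
  length-filterᵇ-≡⇒≡ {p} {q} p⇒q (y ∷ xs) eq x∈
    with p y in py | q y in qy | p⇒q y
  ... | true  | false | h = contradiction (h _) id
  ... | false | true  | _ =
    contradiction (sym eq) (<⇒≢ (s≤s (length-filterᵇ-mono p⇒q xs)))
  length-filterᵇ-≡⇒≡ p⇒q (y ∷ xs) eq (here refl) | false | false | _ = trans qy (sym py)
  length-filterᵇ-≡⇒≡ p⇒q (y ∷ xs) eq (there x∈)  | false | false | _ =
    length-filterᵇ-≡⇒≡ p⇒q xs eq x∈
  length-filterᵇ-≡⇒≡ p⇒q (y ∷ xs) eq (here refl) | true | true | _ = trans qy (sym py)
  length-filterᵇ-≡⇒≡ p⇒q (y ∷ xs) eq (there x∈)  | true | true | _ =
    length-filterᵇ-≡⇒≡ p⇒q xs (suc-injective eq) x∈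

  length-filterᵇ-cong : ∀ {p q : A → Bool} → p ≗ q →
                        ∀ xs → length (filterᵇ p xs) ≡ length (filterᵇ q xs)
  length-filterᵇ-cong {p} {q} p≗q xs = cong length
    (filter-≐ (T? ∘ p) (T? ∘ q)
      ((λ {x} → subst T (p≗q x)) , (λ {x} → subst T (sym (p≗q x)))) xs)

  -- For the deduplicated list of variable sets, this says that distinct elements of the partition
  -- have distinct variable sets.
  lookup-injective : ∀ {xs : List A} → Unique xs → Injective _≡_ _≡_ (lookup xs)
  lookup-injective (_   ∷ _)   {zero}  {zero}  _  = refl
  lookup-injective (x∉  ∷ _)   {zero}  {suc j} eq = contradiction eq (lookupᴬ x∉ (∈-lookup j))
  lookup-injective (x∉  ∷ _)   {suc i} {zero}  eq = contradiction (sym eq) (lookupᴬ x∉ (∈-lookup i))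
  lookup-injective (_   ∷ xs!) {suc i} {suc j} eq = cong suc (lookup-injective xs! eq)

  length-concatMap-≤ : ∀ {B : Set} {f : A → List B} {k} → (∀ x → length (f x) ≤ k) →
                       ∀ xs → length (concatMap f xs) ≤ length xs * k
  length-concatMap-≤ f≤k [] = z≤n
  length-concatMap-≤ {f = f} f≤k (x ∷ xs) = ≤-trans
    (≤-reflexive (length-++ (f x)))
    (+-mono-≤ (f≤k x) (length-concatMap-≤ f≤k xs))

  length-cartesianProductWith : ∀ {B C : Set} (f : A → B → C) xs ys →
    length (cartesianProductWith f xs ys) ≡ length xs * length ys
  length-cartesianProductWith f []       ys = refl
  length-cartesianProductWith f (x ∷ xs) ys = trans
    (length-++ (map (f x) ys))
    (cong₂ _+_ (length-map (f x) ys) (length-cartesianProductWith f xs ys))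

-- Sizes of variable sets and numbers of assignments

∣p∪q∣≤∣p∣+∣q∣ : ∀ {n} (p q : Subset n) → ∣ p ∪ q ∣ ≤ ∣ p ∣ + ∣ q ∣
∣p∪q∣≤∣p∣+∣q∣ []            []            = z≤n
∣p∪q∣≤∣p∣+∣q∣ (outside ∷ p) (outside ∷ q) = ∣p∪q∣≤∣p∣+∣q∣ p q
∣p∪q∣≤∣p∣+∣q∣ (outside ∷ p) (inside  ∷ q) =
  ≤-trans (s≤s (∣p∪q∣≤∣p∣+∣q∣ p q)) (≤-reflexive (sym (+-suc ∣ p ∣ ∣ q ∣)))
∣p∪q∣≤∣p∣+∣q∣ (inside  ∷ p) (outside ∷ q) = s≤s (∣p∪q∣≤∣p∣+∣q∣ p q)
∣p∪q∣≤∣p∣+∣q∣ (inside  ∷ p) (inside  ∷ q) =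
  s≤s (≤-trans (∣p∪q∣≤∣p∣+∣q∣ p q) (+-monoʳ-≤ ∣ p ∣ (n≤1+n ∣ q ∣)))

∣varset∣≤3 : ∀ {n} (c : Clause n) → ∣ varset c ∣ ≤ 3
∣varset∣≤3 (clause ω₁ ω₂ ω₃) = ≤-trans
  (∣p∪q∣≤∣p∣+∣q∣ ⁅ var ω₁ ⁆ _)
  (+-mono-≤ (≤-reflexive (∣⁅x⁆∣≡1 (var ω₁)))
    (≤-trans (∣p∪q∣≤∣p∣+∣q∣ ⁅ var ω₂ ⁆ ⁅ var ω₃ ⁆)
      (+-mono-≤ (≤-reflexive (∣⁅x⁆∣≡1 (var ω₂))) (≤-reflexive (∣⁅x⁆∣≡1 (var ω₃))))))

∈-assignments : ∀ {n} {S : Subset n} (a : Assignment S) → a ∈ assignments S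
∈-assignments []          = here refl
∈-assignments (skip a)    = ∈-map⁺ skip (∈-assignments a)
∈-assignments (true  ∷ a) = ∈-++⁺ˡ (∈-map⁺ (true ∷_) (∈-assignments a))
∈-assignments {S = _ ∷ S} (false ∷ a) =
  ∈-++⁺ʳ (map (true ∷_) (assignments S)) (∈-map⁺ (false ∷_) (∈-assignments a))

length-assignments : ∀ {n} (S : Subset n) → length (assignments S) ≡ 2 ^ ∣ S ∣
length-assignments []            = refl
length-assignments (outside ∷ S) =
  trans (length-map skip (assignments S)) (length-assignments S)
length-assignments (inside ∷ S)  = begin
  length (assignments (inside ∷ S))
    ≡⟨ length-++ (map (true ∷_) (assignments S)) ⟩
  length (map {B = Assignment (inside ∷ S)} (true ∷_) (assignments S)) +
  length (map {B = Assignment (inside ∷ S)} (false ∷_) (assignments S))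
    ≡⟨ cong₂ _+_ (length-map _ (assignments S)) (length-map _ (assignments S)) ⟩
  length (assignments S) + length (assignments S)
    ≡⟨ cong₂ _+_ (length-assignments S)
                 (trans (length-assignments S) (sym (+-identityʳ _))) ⟩
  2 ^ ∣ inside ∷ S ∣ ∎
  where open ≡-Reasoning

-- Size of the clausal partition and length of a pass

module _ {n : ℕ} (E : Instance n) where

  private
    m : ℕ
    m = length (varsets E)

    N : ℕ
    N = n * (n * n)

  varsetᴰ-clause : ∀ d → ∃[ c ] varsetᴰ E d ≡ varset c
  varsetᴰ-clause d =
    let c , _ , eq = ∈-map⁻ varset (∈-deduplicate⁻ _≟ˢ_ (map varset E) (∈-lookup d))
    in c , eq

  -- Signs are dropped, and `combine` packs the triple into one element of `Fin N`, so that an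
  -- injection into this type bounds a cardinality by `N`.
  variables : Clause n → Fin N
  variables (clause ω₁ ω₂ ω₃) = combine (var ω₁) (combine (var ω₂) (var ω₃))

  variables≡⇒varset≡ : ∀ c c′ → variables c ≡ variables c′ → varset c ≡ varset c′
  variables≡⇒varset≡ (clause ω₁ ω₂ ω₃) (clause ω₁′ ω₂′ ω₃′) eq
    with eq₁ , eq₂₃ ← combine-injective (var ω₁) _ (var ω₁′) _ eq
    with eq₂ , eq₃ ← combine-injective (var ω₂) (var ω₃) (var ω₂′) (var ω₃′) eq₂₃
    = cong₂ (λ u S → ⁅ u ⁆ ∪ S) eq₁ (cong₂ (λ v w → ⁅ v ⁆ ∪ ⁅ w ⁆) eq₂ eq₃)

  -- Choosing a clause for each index and taking its triple of variables is injective: equal triples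
  -- give equal variable sets, and each of these occurs only once in `varsets`.
  ∣D∣≤n³ : m ≤ N
  ∣D∣≤n³ = injective⇒≤ {f = variables ∘ proj₁ ∘ varsetᴰ-clause} λ {i} {j} eq →
    let c , i≡c = varsetᴰ-clause i ; c′ , j≡c′ = varsetᴰ-clause j
    in lookup-injective (deduplicate-! _≟ˢ_ (map varset E))
         (trans i≡c (trans (variables≡⇒varset≡ c c′ eq) (sym j≡c′)))

  length-schedule : length (schedule E) ≤ m * m
  length-schedule = ≤-trans
    (length-filter _ (cartesianProduct (allFin m) (allFin m)))
    (≤-reflexive (trans (length-cartesianProductWith _,_ (allFin m) (allFin m))
      (cong₂ _*_ (length-tabulate {n = m} id) (length-tabulate {n = m} id))))

  -- Growth of the constraint sets

  infix 4 _≼_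

  _≼_ : Constraints E → Constraints E → Set
  R ≼ R′ = ∀ d a → T (R d a) → T (R′ d a)

  -- The only constraint set that `∇` rewrites receives a disjunction containing its old value.
  ∇-increasing : ∀ i j R → R ≼ ∇ E i j R
  ∇-increasing i j R k a with k Fin.≟ j
  ... | no  _    = id
  ... | yes refl = Equivalence.from T-∨ ∘ inj₁

  applyAll-increasing : ∀ es R → R ≼ applyAll E es R
  applyAll-increasing []             R d a = id
  applyAll-increasing ((i , j) ∷ es) R d a =
    applyAll-increasing es (∇ E i j R) d a ∘ ∇-increasing i j R d a

  -- The type of an assignment depends on `d`; pairing the two puts the members of all constraint
  -- sets into one list, where a single count covers them.
  DAssignment : Set
  DAssignment = Σ[ d ∈ D E ] Assignment (varsetᴰ E d)

  dassignments : List DAssignment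
  dassignments = concatMap (λ d → map (d ,_) (assignments (varsetᴰ E d))) (allFin m)

  ∈-dassignments : ∀ x → x ∈ dassignments
  ∈-dassignments (d , a) = ∈-concatMap⁺ _
    (Any.map (λ { refl → ∈-map⁺ (d ,_) (∈-assignments a) }) (∈-allFin d))

  -- Each variable set comes from a clause, so it has at most 3 variables and at most 2 ^ 3
  -- assignments.
  length-dassignments : length dassignments ≤ m * 8
  length-dassignments = subst (λ k → length dassignments ≤ k * 8)
    (length-tabulate {n = m} id) (length-concatMap-≤ bound (allFin m))
    where
    bound : ∀ d → length (map {B = DAssignment} (d ,_) (assignments (varsetᴰ E d))) ≤ 8
    bound d with c , eq ← varsetᴰ-clause d = begin
      length (map {B = DAssignment} (d ,_) (assignments (varsetᴰ E d)))
        ≡⟨ length-map {B = DAssignment} (d ,_) (assignments (varsetᴰ E d)) ⟩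
      length (assignments (varsetᴰ E d))
        ≡⟨ length-assignments (varsetᴰ E d) ⟩
      2 ^ ∣ varsetᴰ E d ∣
        ≡⟨ cong (λ S → 2 ^ ∣ S ∣) eq ⟩
      2 ^ ∣ varset c ∣
        ≤⟨ ^-monoʳ-≤ 2 (∣varset∣≤3 c) ⟩
      8 ∎
      where open ≤-Reasoning

  -- The total size of the constraint sets: a potential that no pass lowers and that stalls exactly
  -- at a steady state.
  excluded : ℕ → ℕ
  excluded t = length (filterᵇ (uncurry (constraints E t)) dassignments)

  excluded-mono : ∀ t → excluded t ≤ excluded (suc t)
  excluded-mono t = length-filterᵇ-mono
    (uncurry (applyAll-increasing (schedule E) (constraints E t))) dassignments

  excluded-bound : ∀ t → excluded t ≤ m * 8 + excluded 0
  excluded-bound t = ≤-trans (length-filter _ dassignments)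
    -- The summand `excluded 0` brings the bound into the form that `first-plateau` expects.
    (≤-trans length-dassignments (m≤m+n (m * 8) (excluded 0)))

  -- A pass only enlarges constraint sets, so an equal total leaves every membership as it was; the
  -- cardinalities in `state` then agree as well.
  plateau⇒steady : ∀ t → excluded (suc t) ≡ excluded t → Steady E t
  plateau⇒steady t eq =
    (λ d → length-filterᵇ-cong (cong not ∘ unchanged d) (assignments (varsetᴰ E d))) ,
    unchanged
    where
    unchanged : ∀ d a → constraints E (suc t) d a ≡ constraints E t d a
    unchanged d a = length-filterᵇ-≡⇒≡
      (uncurry (applyAll-increasing (schedule E) (constraints E t)))
      dassignments eq (∈-dassignments (d , a))

  -- This direction gives minimality: an earlier steady time would be an earlier plateau, which
  -- `first-plateau` excludes.
  steady⇒plateau : ∀ t → Steady E t → excluded (suc t) ≡ excluded t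
  steady⇒plateau t (_ , unchanged) = length-filterᵇ-cong (uncurry unchanged) dassignments

  attainsSteadyState : ∃[ t ] (t ≤ m * 8 × AttainsSteadyStateAt E t)
  attainsSteadyState
    with t , t≤8m , eq , least ← first-plateau excluded excluded-mono (m * 8) excluded-bound
    = t , t≤8m , plateau⇒steady t eq , λ s s<t → least s s<t ∘ steady⇒plateau s

  time-bound : ∀ {t} → t ≤ m * 8 → time E t ≤ suc (N * 8) * (N * N)
  time-bound t≤8m = *-mono-≤
    -- The extra 1 is the pass confirming steadiness, which `time` counts.
    (s≤s (≤-trans t≤8m (*-monoˡ-≤ 8 ∣D∣≤n³)))
    (≤-trans length-schedule (*-mono-≤ ∣D∣≤n³ ∣D∣≤n³))

-- (1 + 8 n³) n⁶
timePolynomial : Polynomial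
timePolynomial = 0 ∷ 0 ∷ 0 ∷ 0 ∷ 0 ∷ 0 ∷ 1 ∷ 0 ∷ 0 ∷ 8 ∷ []

eval-timePolynomial : ∀ n → let N = n * (n * n) in
                      suc (N * 8) * (N * N) ≡ eval timePolynomial n
eval-timePolynomial = solve 1
  (λ x → let X = x :* (x :* x) in
    (con 1 :+ X :* con 8) :* (X :* X) :=
    -- The Horner scheme of `eval`, rebuilt in the syntax of the solver so that its meaning unfolds
    -- to `eval timePolynomial n`.
    foldr (λ c r → con c :+ x :* r) (con 0) timePolynomial)
  refl
  where open +-*-Solver

theorem6 : ∃[ p ] ((n : ℕ) (E : Instance n) →
    ∃[ t ] (AttainsSteadyStateAt E t × time E t ≤ eval p n))
theorem6 = timePolynomial , λ n E →
  let t , t≤8m , attained = attainsSteadyState E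
  in t , attained , ≤-trans (time-bound E t≤8m) (≤-reflexive (eval-timePolynomial n))
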